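{- Suppose $k\ge 1$, $\sigma\in F_k(123)$, and $\sigma\ne k\cdots 21$ (the decreasing permutation). Then for all $n\ge 0$ we have $$|F_n(123,\sigma)|=\sum_{j=0}^{k-2}\binom{n-1}{j}.$$ The generating function for this sequence is $$\sum_{n=0}^\infty |F_n(123,\sigma)|x^n = 1+\frac{x(1-x)^{k-1}-x^k}{(1-2x)(1-x)^{k-1}}.$$
   Context: A permutation contains a pattern $\sigma$ if some subsequence of it has the same length and relative order as $\sigma$; otherwise it avoids $\sigma$. A Fishburn permutation is a permutation $\pi$ (in one-line notation) with no subsequence $\pi_j,\pi_{j+1},\pi_k$ such that $j+1<k$, $\pi_j=\pi_k+1$, and $\pi_{j+1}>\pi_j$. $F_n(\sigma_1,\dots,\sigma_m)$ is the set of Fishburn permutations of length $n$ avoiding each $\sigma_i$. Generating functions are formal power series. For $n=0$ the convention $\binom{ -1}{0}=1$ and $\binom{ -1}{j}=0$ for $j\ge1$ is used. -}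

module Defs where

open import Algebra.Bundles.Raw using (RawRing)
import Algebra.Definitions.RawSemiring as RawSemiringDefs
import Algebra.Properties.CommutativeMonoid.Sum as Sum
open import Data.Fin.Base using (Fin; punchIn; zero; suc; toℕ; _<_; finToFun; funToFin)
open import Data.Fin.Permutation as Perm
  using (Permutation′; _⟨$⟩ʳ_; insert; remove; insert-remove; insert-punchIn)
open import Data.Fin.Properties using (_<?_; any?; all?; finToFun-funToFin; punchIn-injective)
open import Data.Integer.Base as ℤ using (ℤ; +_; 0ℤ; 1ℤ)
import Data.Integer.Properties as ℤ
open import Data.List.Base using (List; []; _∷_; [_]; length; filter; allFin; cartesianProductWith)
import Data.List.Membership.Propositional.Properties as Membership
import Data.List.Membership.Setoid.Properties as SetoidMembership
open import Data.List.Relation.Unary.All using (All)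
import Data.List.Relation.Unary.All as All
open import Data.List.Relation.Unary.Any using (here)
import Data.List.Relation.Unary.Enumerates.Setoid as Enumerates
import Data.List.Relation.Unary.Unique.Propositional.Properties as Unique
import Data.List.Relation.Unary.Unique.Setoid as SetoidUnique
import Data.List.Relation.Unary.Unique.Setoid.Properties as SetoidUnique
import Data.List.Relation.Unary.AllPairs as AllPairs
open import Data.Nat.Base as ℕ using (ℕ; zero; suc; _∸_)
open import Data.Nat.Combinatorics using (_C_)
import Data.Nat.Properties as ℕ
open import Data.Product.Base using (Σ; ∃-syntax; _×_; _,_; proj₁; proj₂)
open import Function.Base using (_∘_)
open import Level using (0ℓ)
open import Relation.Binary.Bundles using (Setoid)
open import Relation.Binary.PropositionalEquality
  using (_≡_; _≗_; refl; sym; trans; cong; cong₂; subst₂; setoid; module ≡-Reasoning)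
open import Relation.Nullary using (¬_; Dec)
open import Relation.Nullary.Decidable using (map′; ¬?; _×-dec_; _→-dec_)
open import Relation.Unary using (Pred; Decidable)

private
  variable
    k n : ℕ

-- A permutation π of length n has the one-line notation
-- π ⟨$⟩ʳ 0 , π ⟨$⟩ʳ 1 , … , with positions and values running over
-- 0 , … , n - 1 rather than 1 , … , n.

Pattern : Set
Pattern = Σ ℕ Permutation′

p123 : Pattern
p123 = 3 , Perm.id

-- ι lists the positions, from left to right, of the chosen subsequence.

IsOccurrence : Permutation′ n → Permutation′ k → (Fin k → Fin n) → Set
IsOccurrence π σ ι =
  (∀ a b → a < b → ι a < ι b) ×
  (∀ a b → (σ ⟨$⟩ʳ a < σ ⟨$⟩ʳ b → π ⟨$⟩ʳ ι a < π ⟨$⟩ʳ ι b) ×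
           (π ⟨$⟩ʳ ι a < π ⟨$⟩ʳ ι b → σ ⟨$⟩ʳ a < σ ⟨$⟩ʳ b))

_Contains_ : Permutation′ n → Permutation′ k → Set
π Contains σ = ∃[ ι ] IsOccurrence π σ ι

_Avoids_ : Permutation′ n → Pattern → Set
π Avoids (_ , σ) = ¬ (π Contains σ)

IsFishburn : Permutation′ n → Set
IsFishburn {n} π =
  ¬ (∃[ i ] ∃[ j ] ∃[ l ]
       toℕ j ≡ suc (toℕ i) × j < l ×
       toℕ (π ⟨$⟩ʳ i) ≡ suc (toℕ (π ⟨$⟩ʳ l)) ×
       π ⟨$⟩ʳ i < π ⟨$⟩ʳ j)

F : (n : ℕ) → List Pattern → Pred (Permutation′ n) 0ℓ
F n σs π = IsFishburn π × All (π Avoids_) σs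

isOccurrence? : (π : Permutation′ n) (σ : Permutation′ k) → Decidable (IsOccurrence π σ)
isOccurrence? π σ ι =
  all? (λ a → all? λ b → (a <? b) →-dec (ι a <? ι b)) ×-dec
  all? (λ a → all? λ b →
    ((σ ⟨$⟩ʳ a <? σ ⟨$⟩ʳ b) →-dec (π ⟨$⟩ʳ ι a <? π ⟨$⟩ʳ ι b)) ×-dec
    ((π ⟨$⟩ʳ ι a <? π ⟨$⟩ʳ ι b) →-dec (σ ⟨$⟩ʳ a <? σ ⟨$⟩ʳ b)))

isOccurrence-resp-≗ : (π : Permutation′ n) (σ : Permutation′ k) {ι κ : Fin k → Fin n} →
                      ι ≗ κ → IsOccurrence π σ ι → IsOccurrence π σ κ
isOccurrence-resp-≗ π σ ι≗κ (mono , iso) =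
  (λ a b a<b → subst₂ _<_ (ι≗κ a) (ι≗κ b) (mono a b a<b)) ,
  (λ a b →
    (λ σ< → subst₂ _<_ (cong (π ⟨$⟩ʳ_) (ι≗κ a)) (cong (π ⟨$⟩ʳ_) (ι≗κ b)) (proj₁ (iso a b) σ<)) ,
    (λ π< → proj₂ (iso a b)
      (subst₂ _<_ (cong (π ⟨$⟩ʳ_) (sym (ι≗κ a))) (cong (π ⟨$⟩ʳ_) (sym (ι≗κ b))) π<)))

contains? : (π : Permutation′ n) (σ : Permutation′ k) → Dec (π Contains σ)
contains? π σ = map′
  (λ (i , occ) → finToFun i , occ)
  (λ (ι , occ) → funToFin ι , isOccurrence-resp-≗ π σ (sym ∘ finToFun-funToFin ι) occ)
  (any? (isOccurrence? π σ ∘ finToFun))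

isFishburn? : Decidable (IsFishburn {n})
isFishburn? π = ¬? (any? λ i → any? λ j → any? λ l →
  (toℕ j ℕ.≟ suc (toℕ i)) ×-dec (j <? l) ×-dec
  (toℕ (π ⟨$⟩ʳ i) ℕ.≟ suc (toℕ (π ⟨$⟩ʳ l))) ×-dec
  (π ⟨$⟩ʳ i <? π ⟨$⟩ʳ j))

F? : ∀ n σs → Decidable (F n σs)
F? n σs π = isFishburn? π ×-dec All.all? (λ (_ , σ) → ¬? (contains? π σ)) σs

-- All permutations of length n, listed by their first entry; by the two
-- lemmas below every permutation occurs exactly once, up to pointwise
-- equality.

permutations : ∀ n → List (Permutation′ n)
permutations zero    = [ Perm.id ]
permutations (suc n) = cartesianProductWith (insert zero) (allFin (suc n)) (permutations n)

∣F∣ : ℕ → List Pattern → ℕ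
∣F∣ n σs = length (filter (F? n σs) (permutations n))

≈-setoid : ℕ → Setoid 0ℓ 0ℓ
≈-setoid n = record
  { Carrier       = Permutation′ n
  ; _≈_           = Perm._≈_
  ; isEquivalence = record
    { refl  = λ _ → refl
    ; sym   = λ p i → sym (p i)
    ; trans = λ p q i → trans (p i) (q i)
    }
  }

private
  insert-cong : ∀ {i j : Fin (suc n)} {π ρ : Permutation′ n} → i ≡ j → π Perm.≈ ρ →
                insert zero i π Perm.≈ insert zero j ρ
  insert-cong refl p zero    = refl
  insert-cong {i = i} {π = π} {ρ} refl p (suc a) = begin
    insert zero i π ⟨$⟩ʳ suc a        ≡⟨ insert-punchIn zero i π a ⟩
    _                                 ≡⟨ cong (punchIn i) (p a) ⟩
    _                                 ≡⟨ insert-punchIn zero i ρ a ⟨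
    insert zero i ρ ⟨$⟩ʳ suc a        ∎
    where open ≡-Reasoning

  insert-injective : ∀ {i j : Fin (suc n)} {π ρ : Permutation′ n} →
                     insert zero i π Perm.≈ insert zero j ρ → i ≡ j × π Perm.≈ ρ
  insert-injective {i = i} {π = π} {ρ} p with p zero
  ... | refl = refl , λ a → punchIn-injective i _ _
    (trans (sym (insert-punchIn zero i π a)) (trans (p (suc a)) (insert-punchIn zero i ρ a)))

permutations-complete : ∀ n → Enumerates.IsEnumeration (≈-setoid n) (permutations n)
permutations-complete zero    π = here λ ()
permutations-complete (suc n) π =
  SetoidMembership.∈-resp-≈ (≈-setoid (suc n))
    {x = insert zero (π ⟨$⟩ʳ zero) (remove zero π)} {π} (insert-remove zero π)
    (SetoidMembership.∈-cartesianProductWith⁺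
      (setoid _) (≈-setoid n) (≈-setoid (suc n))
      (λ {i} {j} {π} {ρ} → insert-cong {π = π} {ρ})
      (Membership.∈-allFin (π ⟨$⟩ʳ zero)) (permutations-complete n (remove zero π)))

permutations-unique : ∀ n → SetoidUnique.Unique (≈-setoid n) (permutations n)
permutations-unique zero    = All.[] AllPairs.∷ AllPairs.[]
permutations-unique (suc n) =
  SetoidUnique.cartesianProductWith⁺ (setoid _) (≈-setoid n) (≈-setoid (suc n))
    (insert zero) (λ {i} {j} {π} {ρ} → insert-injective {π = π} {ρ}) (Unique.allFin⁺ (suc n)) (permutations-unique n)

-- binomial[ n -1] j is the binomial coefficient of n - 1 over j, where
-- for n = 0 it is 1 if j = 0 and 0 otherwise.

binomial[_-1] : ℕ → ℕ → ℕ
binomial[ zero  -1] zero    = 1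
binomial[ zero  -1] (suc j) = 0
binomial[ suc n -1] j       = n C j

open Sum ℕ.+-0-commutativeMonoid public using () renaming (sum to Σℕ)

module PowerSeries where

  open Sum ℤ.+-0-commutativeMonoid using (sum)

  Series : Set
  Series = ℕ → ℤ

  infix  4 _≈_
  infixl 6 _+_ _-_
  infixl 7 _*_
  infix  8 -_

  _≈_ : Series → Series → Set
  _≈_ = _≗_

  const : ℤ → Series
  const c zero    = c
  const c (suc n) = 0ℤ

  x : Series
  x zero          = 0ℤ
  x (suc zero)    = 1ℤ
  x (suc (suc n)) = 0ℤ

  _+_ : Series → Series → Series
  (f + g) n = f n ℤ.+ g n

  -_ : Series → Series
  (- f) n = ℤ.- f n

  _-_ : Series → Series → Series
  f - g = f + - g

  _*_ : Series → Series → Series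
  (f * g) n = sum {suc n} λ i → f (toℕ i) ℤ.* g (n ∸ toℕ i)

  rawRing : RawRing 0ℓ 0ℓ
  rawRing = record
    { Carrier = Series ; _≈_ = _≈_
    ; _+_ = _+_ ; _*_ = _*_ ; -_ = -_
    ; 0# = const 0ℤ ; 1# = const 1ℤ
    }

  open RawRing rawRing public using (1#)
  open RawSemiringDefs (RawRing.rawSemiring rawRing) public using (_^_)

  tail : Series → Series
  tail f n = f (suc n)

  -- The quotient f g⁻¹, computed by long division, for a divisor g with
  -- constant coefficient 1 (hence a unit).

  infix 7 _/_⟨_⟩

  _/_⟨_⟩ : (f g : Series) → g 0 ≡ 1ℤ → Series
  (f / g ⟨ g₀≡1 ⟩) zero    = f 0
  (f / g ⟨ g₀≡1 ⟩) (suc n) = ((tail f - const (f 0) * tail g) / g ⟨ g₀≡1 ⟩) n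

  private
    sum-zero : ∀ m → sum {m} (λ _ → 0ℤ) ≡ 0ℤ
    sum-zero zero    = refl
    sum-zero (suc m) = trans (ℤ.+-identityˡ _) (sum-zero m)

    const-* : ∀ c f n → (const c * f) n ≡ c ℤ.* f n
    const-* c f n = trans (cong (λ z → c ℤ.* f n ℤ.+ z) (sum-zero n)) (ℤ.+-identityʳ _)

  /-* : ∀ f g (g₀≡1 : g 0 ≡ 1ℤ) → (f / g ⟨ g₀≡1 ⟩) * g ≈ f
  /-* f g g₀≡1 zero    =
    trans (ℤ.+-identityʳ _) (trans (cong (f 0 ℤ.*_) g₀≡1) (ℤ.*-identityʳ _))
  /-* f g g₀≡1 (suc n) = begin
    a ℤ.+ ((r / g ⟨ g₀≡1 ⟩) * g) n          ≡⟨ cong (λ z → a ℤ.+ z) (/-* r g g₀≡1 n) ⟩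
    a ℤ.+ (f (suc n) ℤ.- (const (f 0) * tail g) n)
      ≡⟨ cong (λ z → a ℤ.+ (f (suc n) ℤ.- z)) (const-* (f 0) (tail g) n) ⟩
    a ℤ.+ (f (suc n) ℤ.- a)                 ≡⟨ cong (λ z → a ℤ.+ z) (ℤ.+-comm (f (suc n)) (ℤ.- a)) ⟩
    a ℤ.+ (ℤ.- a ℤ.+ f (suc n))             ≡⟨ ℤ.+-assoc a (ℤ.- a) (f (suc n)) ⟨
    (a ℤ.- a) ℤ.+ f (suc n)                 ≡⟨ cong (ℤ._+ f (suc n)) (ℤ.+-inverseʳ a) ⟩
    0ℤ ℤ.+ f (suc n)                        ≡⟨ ℤ.+-identityˡ _ ⟩
    f (suc n)                               ∎
    where
    open ≡-Reasoning
    a = f 0 ℤ.* g (suc n)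
    r = tail f - const (f 0) * tail g

  private
    ^-constant : ∀ f → f 0 ≡ 1ℤ → ∀ m → (f ^ m) 0 ≡ 1ℤ
    ^-constant f f₀≡1 zero    = refl
    ^-constant f f₀≡1 (suc m) =
      trans (ℤ.+-identityʳ _) (cong₂ ℤ._*_ f₀≡1 (^-constant f f₀≡1 m))

  denominator-constant : ∀ m → ((1# - const (+ 2) * x) * (1# - x) ^ m) 0 ≡ 1ℤ
  denominator-constant m =
    trans (ℤ.+-identityʳ _) (trans (ℤ.*-identityˡ _) (^-constant (1# - x) refl m))

  generatingFunction : (ℕ → ℕ) → Series
  generatingFunction a n = + a n

{-# OPTIONS --safe #-}

-- In a Fishburn permutation avoiding 123 every adjacent ascent starts at the
-- least value, so the permutation consists of a decreasing run ending in that
-- value, followed by another decreasing run.  It is therefore determined by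
-- the word recording on which side of the least value each other value lies.
-- If σ is not decreasing, an occurrence of σ has to respect the sides, so
-- containing σ means containing the word of σ as a subword.  The number
-- N(m, l) of binary words of length m avoiding a given word of length l
-- satisfies N(m + 1, l + 1) = N(m, l) + N(m, l + 1) by comparing first
-- letters, as do the binomial sums.  For the generating functions G l the
-- recurrence reads (1 - x) G (l + 1) = x + x G l.

module Submission where

open import Defs
import Algebra.Construct.Pointwise as Pointwise
import Algebra.Properties.CommutativeMonoid.Sum as Sum
import Algebra.Properties.Ring as RingProperties
import Algebra.Solver.Ring.NaturalCoefficients.Default as RingSolver
open import Algebra.Bundles using (AbelianGroup; CommutativeRing)
open import Data.Bool.Base using (Bool; true; false; not)
import Data.Bool.Properties as Bool
open import Data.Fin.Base
  using (Fin; zero; suc; toℕ; fromℕ; inject₁; opposite; punchIn; punchOut; _≤_; _<_)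
open import Data.Fin.Induction using (<-weakInduction)
open import Data.Fin.Permutation as Perm
  using (Permutation′; _⟨$⟩ʳ_; _⟨$⟩ˡ_; inverseˡ; inverseʳ; insert; insert-punchIn)
import Data.Fin.Properties as Fin
open import Data.Integer.Base as ℤ using (ℤ; +_; 0ℤ; 1ℤ)
import Data.Integer.Properties as ℤ
open import Data.Integer.Tactic.RingSolver using (solve-∀)
open import Data.List.Base as List using (List; []; _∷_; [_]; _++_; length; filter)
open import Data.List.Membership.Propositional using (_∈_)
open import Data.List.Membership.Propositional.Properties
  using (∈-map⁺; ∈-map⁻; ∈-++⁺ˡ; ∈-++⁺ʳ; ∈-++⁻; ∈-lookup)
import Data.List.Membership.Setoid.Properties as SetoidMembership
open import Data.List.Properties using (length-map; length-++; filter-accept)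
open import Data.List.Relation.Unary.All as All using ([]; _∷_)
open import Data.List.Relation.Unary.AllPairs using ([]; _∷_)
open import Data.List.Relation.Unary.Any as Any using (here)
import Data.List.Relation.Unary.Any.Properties as Any
open import Data.List.Relation.Unary.Enumerates.Setoid using (IsEnumeration)
open import Data.List.Relation.Unary.Unique.Propositional using (Unique)
import Data.List.Relation.Unary.Unique.Propositional.Properties as Unique
import Data.List.Relation.Unary.Unique.Setoid as SetoidUnique
import Data.List.Relation.Unary.Unique.Setoid.Properties as SetoidUnique
open import Data.Nat.Base as ℕ using (ℕ; zero; suc; _∸_; z≤n; s≤s; z<s; s<s)
open import Data.Nat.Combinatorics using (_C_; nCk+nC[k+1]≡[n+1]C[k+1])
import Data.Nat.Properties as ℕ
open import Data.Product.Base using (∃-syntax; _×_; _,_; proj₁; proj₂)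
open import Data.Sum.Base using (inj₁; inj₂)
open import Data.Vec.Base using (Vec; []; _∷_; lookup; tabulate)
import Data.Vec.Properties as Vec
open import Function.Base using (_∘_; id)
open import Level using (0ℓ)
open import Relation.Binary.Bundles using (Setoid)
open import Relation.Binary.Definitions using (tri<; tri≈; tri>)
open import Relation.Binary.PropositionalEquality
  using (_≡_; _≢_; _≗_; refl; sym; trans; cong; cong₂; subst; subst₂; setoid; module ≡-Reasoning)
import Relation.Binary.Reasoning.Setoid as SetoidReasoning
open import Relation.Nullary using (¬_; yes; no; does; proof; contradiction)
open import Relation.Nullary.Reflects using (Reflects; ofʸ; ofⁿ; det)
open import Relation.Unary using (Decidable)
open PowerSeries

private
  module ∑ = Sum ℕ.+-0-commutativeMonoid

private
  variable
    k l m n : ℕ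

-- Strictly increasing maps

StrictlyIncreasing : (Fin k → Fin n) → Set
StrictlyIncreasing f = ∀ a b → a < b → f a < f b

module _ {f : Fin k → Fin n} (f-inc : StrictlyIncreasing f) where

  increasing-cancel-< : ∀ {a b} → f a < f b → a < b
  increasing-cancel-< {a} {b} fa<fb with Fin.<-cmp a b
  ... | tri< a<b _ _ = a<b
  ... | tri≈ _ refl _ = contradiction fa<fb (Fin.<-irrefl refl)
  ... | tri> _ _ b<a = contradiction (f-inc b a b<a) (Fin.<-asym fa<fb)

  increasing-mono-≤ : ∀ {a b} → a ≤ b → f a ≤ f b
  increasing-mono-≤ a≤b = ℕ.≮⇒≥ λ fb<fa → ℕ.<⇒≱ (increasing-cancel-< fb<fa) a≤b

-- Each step to the next index raises the value by at least one. Applied to a permutation and to its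
-- inverse, this shows that an increasing permutation is the identity.
increasing-≥ : {f : Fin k → Fin n} → StrictlyIncreasing f → ∀ a → a ≤ f a
increasing-≥ {suc k} {f = f} f-inc = <-weakInduction (λ a → a ≤ f a) z≤n λ a a≤fa →
  ℕ.≤-<-trans (ℕ.≤-trans (ℕ.≤-reflexive (sym (Fin.toℕ-inject₁ a))) a≤fa)
    (f-inc (inject₁ a) (suc a) (s≤s (ℕ.≤-reflexive (Fin.toℕ-inject₁ a))))

punchIn-mono-< : ∀ i → StrictlyIncreasing (punchIn {n} i)
punchIn-mono-< i a b a<b = ℕ.≰⇒> (ℕ.<⇒≱ a<b ∘ Fin.punchIn-cancel-≤ i b a)

punchIn-cancel-< : ∀ (i : Fin (suc n)) {a b} → punchIn i a < punchIn i b → a < b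
punchIn-cancel-< i = increasing-cancel-< (punchIn-mono-< i)

punchIn-inject₁ : (i : Fin (suc n)) → punchIn (inject₁ i) i ≡ suc i
punchIn-inject₁ zero = refl
punchIn-inject₁ {suc n} (suc i) = cong suc (punchIn-inject₁ i)

data PunchInView (i : Fin (suc n)) : Fin (suc n) → Set where
  hole  : PunchInView i i
  punch : ∀ a → PunchInView i (punchIn i a)

punchIn-view : (i a : Fin (suc n)) → PunchInView i a
punchIn-view i a with i Fin.≟ a
... | yes refl = hole
... | no i≢a   = subst (PunchInView i) (Fin.punchIn-punchOut i≢a) (punch (punchOut i≢a))

insert-hole : ∀ i j (π : Permutation′ n) → insert i j π ⟨$⟩ʳ i ≡ j
insert-hole i j π with i Fin.≟ i
... | yes _  = refl
... | no i≢i = contradiction refl i≢i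

-- Induction on the right end `b`: either the last step before `b` is itself an ascent, or the entry
-- before `b` is at least as large as the one at `b`, hence still above the one at `a`, and the
-- interval can be shortened.
adjacent-ascent : (f : Fin n → Fin m) → ∀ b a → a < b → f a < f b →
                  ∃[ i ] ∃[ j ] toℕ j ≡ suc (toℕ i) × a ≤ i × j ≤ b × f i < f j
adjacent-ascent {suc n} f = <-weakInduction
  (λ b → ∀ a → a < b → f a < f b →
         ∃[ i ] ∃[ j ] toℕ j ≡ suc (toℕ i) × a ≤ i × j ≤ b × f i < f j)
  (λ _ ())
  step
  where
  step : ∀ c → (∀ a → a < inject₁ c → f a < f (inject₁ c) → _) → ∀ a → a < suc c → f a < f (suc c) → _
  step c ih a a<b fa<fb with f (inject₁ c) Fin.<? f (suc c)
  ... | yes fc<fb = inject₁ c , suc c , cong suc (sym (Fin.toℕ-inject₁ c)) ,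
        ℕ.≤-trans (ℕ.s≤s⁻¹ a<b) (ℕ.≤-reflexive (sym (Fin.toℕ-inject₁ c))) , ℕ.≤-refl , fc<fb
  ... | no fc≮fb with Fin.<-cmp a (inject₁ c)
  ...   | tri≈ _ refl _ = contradiction fa<fb fc≮fb
  ...   | tri> _ _ c<a  = contradiction (ℕ.s≤s⁻¹ a<b) (ℕ.<⇒≱ (subst (ℕ._< toℕ a) (Fin.toℕ-inject₁ c) c<a))
  ...   | tri< a<c _ _ with ih a a<c (ℕ.<-≤-trans fa<fb (ℕ.≮⇒≥ fc≮fb))
  ...     | i , j , j≡1+i , a≤i , j≤c , fi<fj = i , j , j≡1+i , a≤i ,
            ℕ.≤-trans j≤c (ℕ.≤-trans (ℕ.≤-reflexive (Fin.toℕ-inject₁ c)) (ℕ.n≤1+n _)) , fi<fj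

reflects-map : ∀ {A B : Set} {b} → (A → B) → (B → A) → Reflects A b → Reflects B b
reflects-map to from (ofʸ a)  = ofʸ (to a)
reflects-map to from (ofⁿ ¬a) = ofⁿ (¬a ∘ from)

true-reflects : ∀ {A : Set} {b} → Reflects A b → b ≡ true → A
true-reflects (ofʸ a) refl = a

⟨$⟩ʳ-injective : (π : Permutation′ n) {a b : Fin n} → π ⟨$⟩ʳ a ≡ π ⟨$⟩ʳ b → a ≡ b
⟨$⟩ʳ-injective π eq = trans (sym (inverseˡ π)) (trans (cong (π ⟨$⟩ˡ_) eq) (inverseˡ π))

≢zero⇒> : {a : Fin (suc n)} → a ≢ zero → zero {n} < a
≢zero⇒> {a = zero}  a≢0 = contradiction refl a≢0
≢zero⇒> {a = suc a} a≢0 = z<s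

-- Fishburn permutations avoiding 123, as words

-- The word of a permutation records for each nonzero value whether it lies
-- to the right of the value 0, which itself gets the letter false.

record Encodes (π : Permutation′ (suc m)) (w : Vec Bool m) : Set where
  field
    bottom       : Fin (suc m)
    bottom-value : π ⟨$⟩ʳ bottom ≡ zero
    side         : ∀ a → Reflects (bottom < a) (lookup (false ∷ w) (π ⟨$⟩ʳ a))
    -- Every ascent crosses the bottom: the entries up to the bottom decrease, and so do those after
    -- it.
    ascent       : ∀ {a b} → a < b → π ⟨$⟩ʳ a < π ⟨$⟩ʳ b → a ≤ bottom × bottom < b

  bottom-unique : ∀ {a} → π ⟨$⟩ʳ a ≡ zero → a ≡ bottom
  bottom-unique πa≡0 = ⟨$⟩ʳ-injective π (trans πa≡0 (sym bottom-value))

  ascent-from-bottom : ∀ {a} → bottom < a → π ⟨$⟩ʳ bottom < π ⟨$⟩ʳ a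
  ascent-from-bottom {a} z<a = subst (_< π ⟨$⟩ʳ a) (sym bottom-value)
    (≢zero⇒> λ πa≡0 → Fin.<-irrefl (sym (bottom-unique πa≡0)) z<a)

open Encodes

encodes-resp-≈ : {π ρ : Permutation′ (suc m)} {w : Vec Bool m} → π Perm.≈ ρ → Encodes π w → Encodes ρ w
encodes-resp-≈ {w = w} π≈ρ e = record
  { bottom       = bottom e
  ; bottom-value = trans (sym (π≈ρ _)) (bottom-value e)
  ; side         = λ a → subst (Reflects _ ∘ lookup (false ∷ w)) (π≈ρ a) (side e a)
  ; ascent       = λ a<b ρa<ρb → ascent e a<b (subst₂ _<_ (sym (π≈ρ _)) (sym (π≈ρ _)) ρa<ρb)
  }

-- The value 0 has only one position, so both words record the same side for every value.
encodes-functional : {π : Permutation′ (suc m)} {w w′ : Vec Bool m} → Encodes π w → Encodes π w′ → w ≡ w′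
encodes-functional {π = π} {w} {w′} e e′ = begin
  w                     ≡⟨ Vec.tabulate∘lookup w ⟨
  tabulate (lookup w)   ≡⟨ Vec.tabulate-cong (λ v → letters (suc v)) ⟩
  tabulate (lookup w′)  ≡⟨ Vec.tabulate∘lookup w′ ⟩
  w′                    ∎
  where
  open ≡-Reasoning
  letters : lookup (false ∷ w) ≗ lookup (false ∷ w′)
  letters v = subst (λ v → lookup (false ∷ w) v ≡ lookup (false ∷ w′) v) (inverseʳ π {v})
    (det (side e a) (subst (λ z → Reflects (z < a) (lookup (false ∷ w′) (π ⟨$⟩ʳ a)))
      (bottom-unique e (bottom-value e′)) (side e′ a)))
    where a = π ⟨$⟩ˡ v

contains-123 : (π : Permutation′ n) {a b c : Fin n} → a < b → b < c →
               π ⟨$⟩ʳ a < π ⟨$⟩ʳ b → π ⟨$⟩ʳ b < π ⟨$⟩ʳ c → π Contains proj₂ p123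
contains-123 π {a} {b} {c} a<b b<c πa<πb πb<πc =
  ι , ι-inc , λ x y → πι-inc x y , increasing-cancel-< πι-inc
  where
  ι : Fin 3 → Fin _
  ι = lookup (a ∷ b ∷ c ∷ [])
  inc : (f : Fin _ → Fin _) → f a < f b → f b < f c → StrictlyIncreasing (f ∘ ι)
  inc f p q zero       (suc zero)       _ = p
  inc f p q zero       (suc (suc zero)) _ = ℕ.<-trans p q
  inc f p q (suc zero) (suc (suc zero)) _ = q
  inc f p q (suc zero)       (suc zero)       x<x = contradiction x<x (ℕ.<-irrefl refl)
  inc f p q (suc (suc zero)) (suc (suc zero)) x<x = contradiction x<x (ℕ.<-irrefl refl)
  inc f p q (suc (suc zero)) (suc zero) (s≤s ())
  ι-inc = inc id a<b b<c
  πι-inc = inc (π ⟨$⟩ʳ_) πa<πb πb<πc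

-- The bottom is the position of the value 0. Between the two ends of any ascent there is an
-- adjacent ascent, and this one has to start at the bottom.
F-123⇒encodes : (π : Permutation′ (suc m)) → F (suc m) (p123 ∷ []) π → ∃[ w ] Encodes π w
F-123⇒encodes {m} π (fishburn , av123 ∷ []) = tabulate (letter ∘ suc) , record
  { bottom       = z
  ; bottom-value = inverseʳ π
  ; side         = λ a → subst (Reflects (z < a)) (letter-lookup a) (proof (z Fin.<? a))
  ; ascent       = asc
  }
  where
  z = π ⟨$⟩ˡ zero
  letter : Fin (suc m) → Bool
  letter v = does (z Fin.<? (π ⟨$⟩ˡ v))

  letter-zero : letter zero ≡ false
  letter-zero = det (proof (z Fin.<? z)) (ofⁿ (Fin.<-irrefl refl))

  lookup-letter : ∀ v → letter v ≡ lookup (false ∷ tabulate (letter ∘ suc)) v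
  lookup-letter zero    = letter-zero
  lookup-letter (suc v) = sym (Vec.lookup∘tabulate (letter ∘ suc) v)

  letter-lookup : ∀ a → does (z Fin.<? a) ≡ lookup (false ∷ tabulate (letter ∘ suc)) (π ⟨$⟩ʳ a)
  letter-lookup a = trans (cong (λ b → does (z Fin.<? b)) (sym (inverseˡ π))) (lookup-letter (π ⟨$⟩ʳ a))

  -- If v + 1 starts an adjacent ascent, then v either lies to its right,
  -- against the Fishburn condition, or to its left and completes a 123.
  ascent-start : ∀ {i j} → toℕ j ≡ suc (toℕ i) → π ⟨$⟩ʳ i < π ⟨$⟩ʳ j → π ⟨$⟩ʳ i ≡ zero
  ascent-start {i} {j} j≡1+i πi<πj with π ⟨$⟩ʳ i in πi≡
  ... | zero  = refl
  ... | suc v = contradiction πi<πj (absurd (Fin.<-cmp p i))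
    where
    p = π ⟨$⟩ˡ inject₁ v
    πp : toℕ (π ⟨$⟩ʳ p) ≡ toℕ v
    πp = trans (cong toℕ (inverseʳ π)) (Fin.toℕ-inject₁ v)
    πi : toℕ (π ⟨$⟩ʳ i) ≡ suc (toℕ v)
    πi = cong toℕ πi≡
    πp<πi : π ⟨$⟩ʳ p < π ⟨$⟩ʳ i
    πp<πi = ℕ.≤-reflexive (trans (cong suc πp) (sym πi))
    i<j : i < j
    i<j = ℕ.≤-reflexive (sym j≡1+i)
    absurd : _ → ¬ (suc v < π ⟨$⟩ʳ j)
    absurd (tri< p<i _ _) sv<πj = av123 (contains-123 π p<i i<j πp<πi (subst (_< π ⟨$⟩ʳ j) (sym πi≡) sv<πj))
    absurd (tri≈ _ p≡i _) sv<πj = Fin.<-irrefl (cong (π ⟨$⟩ʳ_) p≡i) πp<πi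
    absurd (tri> _ _ i<p) sv<πj with Fin.<-cmp p j
    ... | tri< p<j _ _ = ℕ.<⇒≱ p<j (subst (ℕ._≤ toℕ p) (sym j≡1+i) i<p)
    ... | tri≈ _ p≡j _ = Fin.<-asym {x = π ⟨$⟩ʳ p} {π ⟨$⟩ʳ i} πp<πi
                           (subst₂ _<_ (sym πi≡) (cong (π ⟨$⟩ʳ_) (sym p≡j)) sv<πj)
    ... | tri> _ _ j<p = fishburn (i , j , p , j≡1+i , j<p , trans πi (cong suc (sym πp)) ,
                           subst (_< π ⟨$⟩ʳ j) (sym πi≡) sv<πj)

  asc : ∀ {a b} → a < b → π ⟨$⟩ʳ a < π ⟨$⟩ʳ b → a ≤ z × z < b
  asc {a} {b} a<b πa<πb with adjacent-ascent (π ⟨$⟩ʳ_) b a a<b πa<πb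
  ... | i , j , j≡1+i , a≤i , j≤b , πi<πj =
    subst (a ≤_) i≡z a≤i , ℕ.≤-trans (ℕ.≤-reflexive (trans (cong (suc ∘ toℕ) (sym i≡z)) (sym j≡1+i))) j≤b
    where
    i≡z : i ≡ z
    i≡z = trans (sym (inverseˡ π)) (cong (π ⟨$⟩ˡ_) (ascent-start j≡1+i πi<πj))

-- An adjacent ascent crosses the bottom, so it starts there with the value 0, which is no
-- successor. The middle entry of a 123 would lie after the bottom as the end of one ascent and not
-- after it as the start of another.
encodes⇒F-123 : {π : Permutation′ (suc m)} {w : Vec Bool m} → Encodes π w → F (suc m) (p123 ∷ []) π
encodes⇒F-123 {π = π} e = fishburn , av123 ∷ []
  where
  fishburn : IsFishburn π
  fishburn (i , j , l , j≡1+i , _ , πi≡1+πl , πi<πj) with ascent e (ℕ.≤-reflexive (sym j≡1+i)) πi<πj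
  ... | i≤z , z<j = contradiction (trans (sym πi≡1+πl) (cong toℕ πi≡0)) λ ()
    where
    πi≡0 : π ⟨$⟩ʳ i ≡ zero
    πi≡0 = trans
      (cong (π ⟨$⟩ʳ_) (Fin.≤-antisym i≤z (ℕ.s≤s⁻¹ (subst (suc (toℕ (bottom e)) ℕ.≤_) j≡1+i z<j))))
      (bottom-value e)
  av123 : π Avoids p123
  av123 (ι , ι-inc , iso) = ℕ.<⇒≱ (proj₂ (ascents (suc zero) z<s)) (proj₁ (ascents′))
    where
    ascents : ∀ a → zero {2} < a → ι zero ≤ bottom e × bottom e < ι a
    ascents a 0<a = ascent e (ι-inc zero a 0<a) (proj₁ (iso zero a) 0<a)
    ascents′ : ι (suc zero) ≤ bottom e × bottom e < ι (suc (suc zero))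
    ascents′ = ascent e (ι-inc _ _ (s<s z<s)) (proj₁ (iso (suc zero) (suc (suc zero))) (s<s z<s))

-- Pattern containment in terms of words

-- The subword relation, with gaps allowed. Words are functions here, so that the tail of a word is
-- a composition with `suc`.
Embeds : (Fin k → Bool) → (Fin n → Bool) → Set
Embeds p q = ∃[ f ] StrictlyIncreasing f × q ∘ f ≗ p

module _ {σ : Permutation′ (suc l)} {u : Vec Bool l} {π : Permutation′ (suc m)} {w : Vec Bool m}
         (eσ : Encodes σ u) (eπ : Encodes π w) where

  -- Here `f` sends values of `σ` to values of `π` on the same side. If it reversed the positions of
  -- `a < b`, then either `σ` would have an ascent at `a`, `b` or `π` one at the reversed images.
  -- That ascent crosses its bottom, so equal sides force the other pair to cross in the opposite
  -- direction, which its order excludes.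
  positions-increasing : {f : Fin (suc l) → Fin (suc m)} → StrictlyIncreasing f →
    lookup (false ∷ w) ∘ f ≗ lookup (false ∷ u) →
    StrictlyIncreasing (λ a → π ⟨$⟩ˡ f (σ ⟨$⟩ʳ a))
  positions-increasing {f} f-inc letters a b a<b with Fin.<-cmp (π ⟨$⟩ˡ f (σ ⟨$⟩ʳ a)) (π ⟨$⟩ˡ f (σ ⟨$⟩ʳ b))
  ... | tri< p<q _ _ = p<q
  ... | tri≈ _ p≡q _ = contradiction (trans (sym (value a)) (trans (cong (π ⟨$⟩ʳ_) p≡q) (value b)))
                         (distinct (Fin.<-cmp (σ ⟨$⟩ʳ a) (σ ⟨$⟩ʳ b)))
    where
    value : ∀ a → π ⟨$⟩ʳ (π ⟨$⟩ˡ f (σ ⟨$⟩ʳ a)) ≡ f (σ ⟨$⟩ʳ a)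
    value a = inverseʳ π
    distinct : _ → f (σ ⟨$⟩ʳ a) ≢ f (σ ⟨$⟩ʳ b)
    distinct (tri< σa<σb _ _) eq = Fin.<-irrefl eq (f-inc _ _ σa<σb)
    distinct (tri≈ _ σa≡σb _) eq = Fin.<-irrefl (⟨$⟩ʳ-injective σ σa≡σb) a<b
    distinct (tri> _ _ σb<σa) eq = Fin.<-irrefl (sym eq) (f-inc _ _ σb<σa)
  ... | tri> _ _ q<p = contradiction q<p (≮ (Fin.<-cmp (σ ⟨$⟩ʳ a) (σ ⟨$⟩ʳ b)))
    where
    p = π ⟨$⟩ˡ f (σ ⟨$⟩ʳ a)
    q = π ⟨$⟩ˡ f (σ ⟨$⟩ʳ b)
    letter : ∀ a → lookup (false ∷ w) (π ⟨$⟩ʳ (π ⟨$⟩ˡ f (σ ⟨$⟩ʳ a))) ≡ lookup (false ∷ u) (σ ⟨$⟩ʳ a)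
    letter a = trans (cong (lookup (false ∷ w)) (inverseʳ π)) (letters _)
    to : ∀ {a} → bottom eσ < a → bottom eπ < (π ⟨$⟩ˡ f (σ ⟨$⟩ʳ a))
    to {a} z<a = true-reflects (side eπ _) (trans (letter a) (det (side eσ a) (ofʸ z<a)))
    from : ∀ {a} → bottom eπ < (π ⟨$⟩ˡ f (σ ⟨$⟩ʳ a)) → bottom eσ < a
    from {a} z<a = true-reflects (side eσ a) (trans (sym (letter a)) (det (side eπ _) (ofʸ z<a)))
    ≮ : _ → ¬ (q < p)
    ≮ (tri< σa<σb _ _) q<p with ascent eσ a<b σa<σb
    ... | a≤z , z<b = ℕ.<⇒≱ (from (ℕ.<-trans (to z<b) q<p)) a≤z
    ≮ (tri≈ _ σa≡σb _) q<p = Fin.<-irrefl (⟨$⟩ʳ-injective σ σa≡σb) a<b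
    ≮ (tri> _ _ σb<σa) q<p
      with ascent eπ q<p (subst₂ _<_ (sym (inverseʳ π)) (sym (inverseʳ π)) (f-inc _ _ σb<σa))
    ... | q≤z , z<p = ℕ.<⇒≱ (to (ℕ.<-trans (from z<p) a<b)) q≤z

  embeds⇒contains : Embeds (lookup (false ∷ u)) (lookup (false ∷ w)) → π Contains σ
  embeds⇒contains (f , f-inc , letters) =
    (λ a → π ⟨$⟩ˡ f (σ ⟨$⟩ʳ a)) , positions-increasing f-inc letters , λ a b →
      (λ σa<σb → subst₂ _<_ (sym (inverseʳ π)) (sym (inverseʳ π)) (f-inc _ _ σa<σb)) ,
      (λ πa<πb → increasing-cancel-< f-inc (subst₂ _<_ (inverseʳ π) (inverseʳ π) πa<πb))

  -- An ascent of σ pins the image of its bottom to the left part of π.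
  contains⇒embeds : ∀ {r} → bottom eσ < r → π Contains σ →
                    Embeds (lookup (false ∷ u)) (lookup (false ∷ w))
  contains⇒embeds {r} z<r (ι , ι-inc , iso) = f , f-inc , letters
    where
    f : Fin (suc l) → Fin (suc m)
    f v = π ⟨$⟩ʳ ι (σ ⟨$⟩ˡ v)
    f-inc : StrictlyIncreasing f
    f-inc v v′ v<v′ = proj₁ (iso _ _) (subst₂ _<_ (sym (inverseʳ σ)) (sym (inverseʳ σ)) v<v′)
    after : ∀ {a} → bottom eσ < a → ι (bottom eσ) ≤ bottom eπ × bottom eπ < ι a
    after {a} z<a = ascent eπ (ι-inc _ _ z<a) (proj₁ (iso _ _) (ascent-from-bottom eσ z<a))
    before : ∀ {a} → bottom eπ < ι a → bottom eσ < a
    before z<ιa = increasing-cancel-< ι-inc (ℕ.≤-<-trans (proj₁ (after z<r)) z<ιa)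
    letters : lookup (false ∷ w) ∘ f ≗ lookup (false ∷ u)
    letters v = trans (det (side eπ _) (reflects-map (proj₂ ∘ after) before (side eσ (σ ⟨$⟩ˡ v))))
      (cong (lookup (false ∷ u)) (inverseʳ σ))

-- The identity on values preserves the letters of a common word, so matching the positions of equal
-- values is increasing in both directions and thus fixes every position.
encodes-injective : {π ρ : Permutation′ (suc m)} {w : Vec Bool m} → Encodes π w → Encodes ρ w → π Perm.≈ ρ
encodes-injective {m} {π} {ρ} eπ eρ a = trans (cong (π ⟨$⟩ʳ_) (sym fixed)) (inverseʳ π)
  where
  ≥ : ∀ {π ρ : Permutation′ (suc m)} {w} → Encodes π w → Encodes ρ w → ∀ a → a ≤ π ⟨$⟩ˡ (ρ ⟨$⟩ʳ a)
  ≥ eπ eρ = increasing-≥ (positions-increasing eρ eπ (λ _ _ → id) (λ _ → refl))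
  fixed : π ⟨$⟩ˡ (ρ ⟨$⟩ʳ a) ≡ a
  fixed = Fin.≤-antisym
    (subst (π ⟨$⟩ˡ (ρ ⟨$⟩ʳ a) ≤_) (trans (cong (ρ ⟨$⟩ˡ_) (inverseʳ π)) (inverseˡ ρ)) (≥ eρ eπ _))
    (≥ eπ eρ a)

-- With the value 0 in last place every letter is `false`. The decreasing permutation has the same
-- word, and the word determines the permutation.
encodes-reverse : {π : Permutation′ (suc m)} {w : Vec Bool m} (e : Encodes π w) →
                  bottom e ≡ fromℕ m → π Perm.≈ Perm.reverse
encodes-reverse {m} {π} {w} e z≡last = encodes-injective {ρ = Perm.reverse} e record
  { bottom       = fromℕ m
  ; bottom-value = Fin.toℕ-injective (begin
      toℕ (opposite (fromℕ m))      ≡⟨ Fin.opposite-prop (fromℕ m) ⟩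
      m ℕ.∸ toℕ (fromℕ m)           ≡⟨ cong (m ℕ.∸_) (Fin.toℕ-fromℕ m) ⟩
      m ℕ.∸ m                       ≡⟨ ℕ.n∸n≡0 m ⟩
      0                             ∎)
  ; side         = λ a → subst (Reflects (fromℕ m < a)) (sym (all-false (opposite a))) (ofⁿ (last-≮ refl))
  ; ascent       = λ {a} {b} a<b ↑ → contradiction a<b (ℕ.<⇒≯ (opposite-cancel-< ↑))
  }
  where
  open ≡-Reasoning
  last-≮ : ∀ {i a} → i ≡ fromℕ m → ¬ (i < a)
  last-≮ refl i<a = ℕ.<⇒≱ i<a (Fin.≤fromℕ _)
  all-false : ∀ v → lookup (false ∷ w) v ≡ false
  all-false v = subst (λ v → lookup (false ∷ w) v ≡ false) (inverseʳ π)
    (det (side e (π ⟨$⟩ˡ v)) (ofⁿ (last-≮ z≡last)))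
  opposite-cancel-< : ∀ {a b : Fin (suc m)} → opposite a < opposite b → b < a
  opposite-cancel-< {a} {b} ↑ = ℕ.≰⇒> λ a≤b → ℕ.<⇒≱ ↑
    (subst₂ ℕ._≤_ (sym (Fin.opposite-prop b)) (sym (Fin.opposite-prop a)) (ℕ.∸-monoʳ-≤ (suc m) (s≤s a≤b)))

-- The last position then serves as the entry after the bottom that `contains⇒embeds` asks for.
not-reverse⇒ascent : {π : Permutation′ (suc m)} {w : Vec Bool m} (e : Encodes π w) →
                     ¬ (π Perm.≈ Perm.reverse) → bottom e < fromℕ m
not-reverse⇒ascent {m} e π≉rev =
  Fin.≤∧≢⇒< (Fin.≤fromℕ (bottom e)) (π≉rev ∘ encodes-reverse e)

-- Decoding words

-- The first letter belongs to the value 1, which goes right before 0 or to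
-- the very end.
insert-one : {π : Permutation′ (suc m)} {w : Vec Bool m} (b : Bool) → Encodes π w →
             ∃[ τ ] Encodes τ (b ∷ w)
insert-one {m} {π} {w} b e = τ , record
  { bottom       = z′
  ; bottom-value = trans (old z) (cong (punchIn (suc zero)) (bottom-value e))
  ; side         = sides
  ; ascent       = λ {x} {y} → ascents (punchIn-view i x) (punchIn-view i y)
  }
  where
  z = bottom e

  position : Bool → Fin (suc (suc m))
  position false = inject₁ z
  position true  = fromℕ (suc m)

  i  = position b
  z′ = punchIn i z
  τ  = insert i (suc zero) π

  old : ∀ a → τ ⟨$⟩ʳ punchIn i a ≡ punchIn (suc zero) (π ⟨$⟩ʳ a)
  old = insert-punchIn i (suc zero) π

  new : τ ⟨$⟩ʳ i ≡ suc zero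
  new = insert-hole i (suc zero) π

  lookup-punchIn : ∀ v → lookup (false ∷ b ∷ w) (punchIn (suc zero) v) ≡ lookup (false ∷ w) v
  lookup-punchIn zero    = refl
  lookup-punchIn (suc v) = refl

  side-new : ∀ b → Reflects (punchIn (position b) z < position b) b
  side-new false = ofⁿ λ lt → ℕ.<⇒≱ lt (subst₂ ℕ._≤_ (sym (Fin.toℕ-inject₁ z))
    (cong toℕ (sym (punchIn-inject₁ z))) (ℕ.n≤1+n _))
  side-new true  = ofʸ (Fin.≤∧≢⇒< (Fin.≤fromℕ _) (Fin.punchInᵢ≢i _ z))

  sides : ∀ a → Reflects (z′ < a) (lookup (false ∷ b ∷ w) (τ ⟨$⟩ʳ a))
  sides a with punchIn-view i a
  ... | hole    = subst (Reflects (z′ < i) ∘ lookup (false ∷ b ∷ w)) (sym new) (side-new b)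
  ... | punch a = subst (Reflects _)
    (sym (trans (cong (lookup (false ∷ b ∷ w)) (old a)) (lookup-punchIn (π ⟨$⟩ʳ a))))
    (reflects-map (punchIn-mono-< i z a) (punchIn-cancel-< i) (side e a))

  below-one : ∀ {v : Fin (suc m)} → punchIn (suc zero) v < suc (zero {m}) → v ≡ zero
  below-one {zero} _ = refl
  below-one {suc v} (s≤s ())

  -- Ascents starting at the new value 1: at the very end nothing follows it, and right before 0
  -- every later entry other than 0 lies past the bottom.
  after-new : ∀ b y → position b < punchIn (position b) y → y ≢ z →
              position b ≤ punchIn (position b) z × punchIn (position b) z < punchIn (position b) y
  after-new true  y lt _   = contradiction lt (ℕ.≤⇒≯ (Fin.≤fromℕ _))
  after-new false y lt y≢z =
    subst₂ ℕ._≤_ (sym (Fin.toℕ-inject₁ z)) (cong toℕ (sym (punchIn-inject₁ z))) (ℕ.n≤1+n _) ,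
    Fin.≤∧≢⇒<
      (subst₂ ℕ._≤_ (trans (cong suc (Fin.toℕ-inject₁ z)) (cong toℕ (sym (punchIn-inject₁ z)))) refl lt)
      (y≢z ∘ sym ∘ Fin.punchIn-injective _ z y)

  ascents : ∀ {x y} → PunchInView i x → PunchInView i y → x < y → τ ⟨$⟩ʳ x < τ ⟨$⟩ʳ y → x ≤ z′ × z′ < y
  ascents hole hole x<x _ = contradiction x<x (ℕ.<-irrefl refl)
  ascents hole (punch y) x<y ↑ = after-new b y x<y λ { refl →
    contradiction (subst₂ _<_ new (trans (old z) (cong (punchIn (suc zero)) (bottom-value e))) ↑) λ () }
  ascents (punch x) hole x<y ↑ = ℕ.≤-reflexive (cong toℕ x≡z′) , subst (_< _) x≡z′ x<y
    where
    x≡z′ : punchIn i x ≡ z′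
    x≡z′ = cong (punchIn i) (bottom-unique e (below-one (subst₂ _<_ (old x) new ↑)))
  ascents (punch x) (punch y) x<y ↑ with ascent e (punchIn-cancel-< i x<y)
    (punchIn-cancel-< (suc zero) (subst₂ _<_ (old x) (old y) ↑))
  ... | x≤z , z<y = Fin.punchIn-mono-≤ i x z x≤z , punchIn-mono-< i z y z<y

decode : (w : Vec Bool m) → ∃[ π ] Encodes π w
decode []      = Perm.id , record
  { bottom       = zero
  ; bottom-value = refl
  ; side         = λ { zero → ofⁿ λ () }
  ; ascent       = λ { {zero} {zero} () }
  }
decode (b ∷ w) = insert-one b (proj₂ (decode w))

-- Words avoiding a subword

shift : (f : Fin k → Fin (suc n)) → StrictlyIncreasing f → (∀ a → zero {n} < f a) →
        ∃[ g ] StrictlyIncreasing g × suc ∘ g ≗ f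
shift f f-inc f>0 = g , (λ a b a<b → ℕ.s<s⁻¹ (subst₂ _<_ (eq a) (eq b) (f-inc a b a<b))) , sym ∘ eq
  where
  positive : ∀ {n} {x : Fin (suc n)} → zero {n} < x → ∃[ y ] x ≡ suc y
  positive {x = suc y} _ = y , refl
  g = λ a → proj₁ (positive (f>0 a))
  eq : ∀ a → f a ≡ suc (g a)
  eq a = proj₂ (positive (f>0 a))

module _ {q : Fin (suc n) → Bool} where

  embeds-skip : {p : Fin k → Bool} → Embeds p (q ∘ suc) → Embeds p q
  embeds-skip (f , f-inc , eq) = suc ∘ f , (λ a b a<b → s<s (f-inc a b a<b)) , eq

  embeds-into-tail : {p : Fin k → Bool} → ((f , _) : Embeds p q) → (∀ a → zero {n} < f a) → Embeds p (q ∘ suc)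
  embeds-into-tail (f , f-inc , eq) f>0 with shift f f-inc f>0
  ... | g , g-inc , suc∘g≗f = g , g-inc , λ a → trans (cong q (suc∘g≗f a)) (eq a)

  module _ {p : Fin (suc k) → Bool} where

    embeds-keep : q zero ≡ p zero → Embeds (p ∘ suc) (q ∘ suc) → Embeds p q
    embeds-keep q₀≡p₀ (f , f-inc , eq) = f′ , inc , λ { zero → q₀≡p₀ ; (suc a) → eq a }
      where
      f′ : Fin (suc k) → Fin (suc n)
      f′ zero    = zero
      f′ (suc a) = suc (f a)
      inc : StrictlyIncreasing f′
      inc zero    (suc b) _       = z<s
      inc (suc a) (suc b) (s<s a<b) = s<s (f-inc a b a<b)

    -- Only the first letter of `p` can be matched with the first letter of `q`; all others go
    -- strictly further right.
    embeds-tail : Embeds p q → Embeds (p ∘ suc) (q ∘ suc)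
    embeds-tail (f , f-inc , eq) = embeds-into-tail
      (f ∘ suc , (λ a b a<b → f-inc _ _ (s<s a<b)) , eq ∘ suc)
      (λ a → ℕ.≤-<-trans z≤n (f-inc zero (suc a) z<s))

    -- The first letter of `p` cannot be matched at position 0, and by monotonicity neither can any
    -- other.
    embeds-unskip : q zero ≢ p zero → Embeds p q → Embeds p (q ∘ suc)
    embeds-unskip q₀≢p₀ e@(f , f-inc , eq) = embeds-into-tail e λ a →
      ℕ.<-≤-trans (≢zero⇒> λ f₀≡0 → q₀≢p₀ (trans (cong q (sym f₀≡0)) (eq zero)))
        (increasing-mono-≤ f-inc z≤n)

_⊑_ : Vec Bool l → Vec Bool m → Set
u ⊑ w = Embeds (lookup u) (lookup w)

-- Leftmost matching: a word starting with `a` uses up that letter of the subword, and one starting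
-- with `not a` leaves the subword as it is. The empty subword occurs in every word.
avoiders : Vec Bool l → ∀ m → List (Vec Bool m)
avoiders []      m       = []
avoiders (a ∷ u) zero    = [ [] ]
avoiders (a ∷ u) (suc m) = List.map (a ∷_) (avoiders u m) ++ List.map (not a ∷_) (avoiders (a ∷ u) m)

∈-avoiders⁻ : (u : Vec Bool l) {w : Vec Bool m} → w ∈ avoiders u m → ¬ (u ⊑ w)
∈-avoiders⁻ {m = zero}  (a ∷ u) _ (f , _) = contradiction (f zero) λ ()
∈-avoiders⁻ {m = suc m} (a ∷ u) w∈ e with ∈-++⁻ (List.map (a ∷_) (avoiders u m)) w∈
... | inj₁ w∈ˡ with ∈-map⁻ (a ∷_) w∈ˡ
...   | _ , w∈ , refl = ∈-avoiders⁻ u w∈ (embeds-tail {q = lookup (a ∷ _)} e)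
∈-avoiders⁻ {m = suc m} (a ∷ u) _ e | inj₂ w∈ʳ with ∈-map⁻ (not a ∷_) w∈ʳ
...   | _ , w∈ , refl = ∈-avoiders⁻ (a ∷ u) w∈ (embeds-unskip {q = lookup (not a ∷ _)} (Bool.not-¬ refl ∘ sym) e)

∈-avoiders⁺ : (u : Vec Bool l) {w : Vec Bool m} → ¬ (u ⊑ w) → w ∈ avoiders u m
∈-avoiders⁺ []      ¬e = contradiction ((λ ()) , (λ ()) , λ ()) ¬e
∈-avoiders⁺ (a ∷ u) {[]} ¬e = here refl
∈-avoiders⁺ (a ∷ u) {b ∷ w} ¬e with b Bool.≟ a
... | yes refl = ∈-++⁺ˡ (∈-map⁺ (a ∷_) (∈-avoiders⁺ u (¬e ∘ embeds-keep {q = lookup (a ∷ _)} refl)))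
... | no b≢a rewrite Bool.¬-not b≢a =
  ∈-++⁺ʳ _ (∈-map⁺ (not a ∷_) (∈-avoiders⁺ (a ∷ u) (¬e ∘ embeds-skip {q = lookup (not a ∷ _)})))

avoiders-unique : (u : Vec Bool l) → ∀ m → Unique (avoiders u m)
avoiders-unique []      m       = []
avoiders-unique (a ∷ u) zero    = [] ∷ []
avoiders-unique (a ∷ u) (suc m) = Unique.++⁺
  (Unique.map⁺ Vec.∷-injectiveʳ (avoiders-unique u m))
  (Unique.map⁺ Vec.∷-injectiveʳ (avoiders-unique (a ∷ u) m))
  λ (∈ˡ , ∈ʳ) → disjoint (∈-map⁻ (a ∷_) ∈ˡ) (∈-map⁻ (not a ∷_) ∈ʳ)
  where
  disjoint : ∀ {w} → (∃[ v ] v ∈ avoiders u m × w ≡ a ∷ v) →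
             ¬ (∃[ v ] v ∈ avoiders (a ∷ u) m × w ≡ not a ∷ v)
  disjoint (_ , _ , refl) (_ , _ , eq) = Bool.not-¬ refl (Vec.∷-injectiveˡ eq)

-- Binomial sums and the number of words avoiding a subword

binomialSum : ℕ → ℕ → ℕ
binomialSum l m = Σℕ {l} (λ j → m C toℕ j)

-- Pascal's rule for all terms but the one at `j = 0`; this 1 becomes the first term of the longer
-- sum on the right.
binomialSum-suc : ∀ l m → binomialSum (suc l) (suc m) ≡ binomialSum l m ℕ.+ binomialSum (suc l) m
binomialSum-suc l m = begin
  1 ℕ.+ Σℕ {l} (λ j → suc m C suc (toℕ j))
    ≡⟨ cong suc (∑.sum-cong-≗ {l} λ j → nCk+nC[k+1]≡[n+1]C[k+1] m (toℕ j)) ⟨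
  1 ℕ.+ Σℕ {l} (λ j → m C toℕ j ℕ.+ m C suc (toℕ j))
    ≡⟨ cong suc (∑.∑-distrib-+ {l} (λ j → m C toℕ j) (λ j → m C suc (toℕ j))) ⟩
  1 ℕ.+ (binomialSum l m ℕ.+ Σℕ {l} (λ j → m C suc (toℕ j)))
    ≡⟨ ℕ.+-suc (binomialSum l m) _ ⟨
  binomialSum l m ℕ.+ binomialSum (suc l) m ∎
  where open ≡-Reasoning

binomialSum-zero : ∀ l → binomialSum (suc l) 0 ≡ 1
binomialSum-zero l = cong suc (∑.sum-replicate-zero l)

-- Both sides obey the same recursion. The count depends on `u` through its length alone, which is
-- why the final formula sees only the length of `σ`.
length-avoiders : (u : Vec Bool l) → ∀ m → length (avoiders u m) ≡ binomialSum l m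
length-avoiders {zero}  []      m       = refl
length-avoiders {suc l} (a ∷ u) zero    = sym (binomialSum-zero l)
length-avoiders {suc l} (a ∷ u) (suc m) = begin
  length (List.map (a ∷_) (avoiders u m) ++ List.map (not a ∷_) (avoiders (a ∷ u) m))
    ≡⟨ length-++ (List.map (a ∷_) (avoiders u m)) ⟩
  length (List.map (a ∷_) (avoiders u m)) ℕ.+ length (List.map (not a ∷_) (avoiders (a ∷ u) m))
    ≡⟨ cong₂ ℕ._+_ (length-map _ (avoiders u m)) (length-map _ (avoiders (a ∷ u) m)) ⟩
  length (avoiders u m) ℕ.+ length (avoiders (a ∷ u) m)
    ≡⟨ cong₂ ℕ._+_ (length-avoiders u m) (length-avoiders (a ∷ u) m) ⟩
  binomialSum l m ℕ.+ binomialSum (suc l) m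
    ≡⟨ binomialSum-suc l m ⟨
  binomialSum (suc l) (suc m) ∎
  where open ≡-Reasoning

-- Counting permutations by their words

module _ {c ℓ} (S : Setoid c ℓ) where
  open Setoid S using (Carrier) renaming (_≈_ to _≋_; sym to ≋-sym)

  unique-lookup : ∀ {xs} → SetoidUnique.Unique S xs → ∀ i j → List.lookup xs i ≋ List.lookup xs j → i ≡ j
  unique-lookup (x∉ ∷ xs!) zero    zero    _  = refl
  unique-lookup (x∉ ∷ xs!) zero    (suc j) eq = contradiction eq (All.lookup x∉ (∈-lookup j))
  unique-lookup (x∉ ∷ xs!) (suc i) zero    eq = contradiction (≋-sym eq) (All.lookup x∉ (∈-lookup i))
  unique-lookup (x∉ ∷ xs!) (suc i) (suc j) eq = cong suc (unique-lookup xs! i j eq)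

  -- The choice of matching indices is injective, because entries matched with the same partner are
  -- equal and the first list has no repetitions.
  length-≤ : ∀ {b r} {B : Set b} (R : Carrier → B → Set r) → (∀ {x x′ y} → R x y → R x′ y → x ≋ x′) →
             ∀ {xs ys} → SetoidUnique.Unique S xs → (∀ i → ∃[ j ] R (List.lookup xs i) (List.lookup ys j)) →
             length xs ℕ.≤ length ys
  length-≤ R R-inj {xs} {ys} xs! match = Fin.injective⇒≤ {f = proj₁ ∘ match} λ {i} {j} eq →
    unique-lookup xs! i j (R-inj (proj₂ (match i))
      (subst (R (List.lookup xs j) ∘ List.lookup ys) (sym eq) (proj₂ (match j))))

module _ {c ℓ p b r} (S : Setoid c ℓ) {P : Setoid.Carrier S → Set p} (P? : Decidable P)
         {B : Set b} (R : Setoid.Carrier S → B → Set r) where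
  open Setoid S using (Carrier) renaming (_≈_ to _≋_)

  -- A bijection given as a relation, since permutations are compared only up to pointwise equality.
  -- It bounds each length by the other.
  length-filter-≡ : (∀ {x x′ y} → R x y → R x′ y → x ≋ x′) → (∀ {x y y′} → R x y → R x y′ → y ≡ y′) →
    (∀ {x x′ y} → x ≋ x′ → R x y → R x′ y) →
    ∀ {xs ys} → SetoidUnique.Unique S xs → IsEnumeration S xs → Unique ys →
    (∀ {x} → P x → ∃[ y ] R x y × y ∈ ys) → (∀ {y} → y ∈ ys → ∃[ x ] R x y) →
    (∀ {x y} → R x y → y ∈ ys → P x) →
    length (filter P? xs) ≡ length ys
  length-filter-≡ R-inj R-fun R-resp {xs} {ys} xs! xs-all ys! to from sound = ℕ.≤-antisym
    (length-≤ S R R-inj {ys = ys} (SetoidUnique.filter⁺ S P? xs!) match)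
    (length-≤ (setoid B) (λ y x → R x y) R-fun {ys = filter P? xs} ys! match′)
    where
    -- Membership in a filtered list over a setoid needs `P` to respect the equality; this is
    -- obtained by moving the partner of `x` to `x′`.
    P-resp : ∀ {x x′} → x ≋ x′ → P x → P x′
    P-resp x≋x′ Px with to Px
    ... | y , Rxy , y∈ = sound (R-resp x≋x′ Rxy) y∈
    match : ∀ i → ∃[ j ] R (List.lookup (filter P? xs) i) (List.lookup ys j)
    match i with to (proj₂ (SetoidMembership.∈-filter⁻ S P? P-resp {xs = xs}
                   (SetoidMembership.∈-lookup S (filter P? xs) i)))
    ... | y , Rxy , y∈ = Any.index y∈ , subst (R _) (Any.lookup-index y∈) Rxy
    match′ : ∀ j → ∃[ i ] R (List.lookup (filter P? xs) i) (List.lookup ys j)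
    match′ j with from (∈-lookup j)
    ... | x , Rxy = Any.index x∈ , R-resp (Any.lookup-index x∈) Rxy
      where
      x∈ : Any.Any (x ≋_) (filter P? xs)
      x∈ = SetoidMembership.∈-filter⁺ S P? P-resp (xs-all x) (sound Rxy (∈-lookup j))

-- The number of Fishburn permutations avoiding 123 and `σ`

module _ {σ : Permutation′ (suc l)} {u : Vec Bool l}
         (eσ : Encodes σ u) (σ≉rev : ¬ (σ Perm.≈ Perm.reverse)) where

  private
    patterns : List Pattern
    patterns = p123 ∷ (suc l , σ) ∷ []

  -- Containment compares the words with the letter `false` of the value 0 put in front. Both have
  -- it, so an embedding of `u` into `w` extends by `embeds-keep`; the converse below strips it by
  -- `embeds-tail`.
  F⇒encodes : {π : Permutation′ (suc m)} → F (suc m) patterns π → ∃[ w ] Encodes π w × ¬ (u ⊑ w)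
  F⇒encodes {π = π} (fishburn , av123 ∷ avσ ∷ []) with F-123⇒encodes π (fishburn , av123 ∷ [])
  ... | w , eπ = w , eπ , avσ ∘ embeds⇒contains eσ eπ ∘ embeds-keep {q = lookup (false ∷ w)} refl

  encodes⇒F : {π : Permutation′ (suc m)} {w : Vec Bool m} → Encodes π w → ¬ (u ⊑ w) → F (suc m) patterns π
  encodes⇒F {w = w} eπ u⋢w with encodes⇒F-123 eπ
  ... | fishburn , av123 ∷ [] = fishburn ,
    av123 ∷
    (u⋢w ∘ embeds-tail {q = lookup (false ∷ w)} ∘
      contains⇒embeds eσ eπ (not-reverse⇒ascent eσ σ≉rev)) ∷ []

  ∣F∣-suc : ∀ m → ∣F∣ (suc m) patterns ≡ binomialSum l m
  ∣F∣-suc m = trans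
    (length-filter-≡ (≈-setoid (suc m)) (F? (suc m) patterns) Encodes
      encodes-injective encodes-functional encodes-resp-≈
      (permutations-unique (suc m)) (permutations-complete (suc m)) (avoiders-unique u m)
      (λ {π} → toWord {π}) (λ {w} _ → decode w)
      (λ {π} {w} e w∈ → encodes⇒F {π = π} {w} e (∈-avoiders⁻ u w∈)))
    (length-avoiders u m)
    where
    toWord : {π : Permutation′ (suc m)} → F (suc m) patterns π → ∃[ w ] Encodes π w × w ∈ avoiders u m
    toWord {π} Fπ with F⇒encodes {π = π} Fπ
    ... | w , eπ , u⋢w = w , eπ , ∈-avoiders⁺ u u⋢w

  ∣F∣-zero : ∣F∣ 0 patterns ≡ 1
  ∣F∣-zero = cong length (filter-accept (F? 0 patterns) {x = Perm.id} {xs = []}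
    ((λ ()) , (λ (ι , _) → contradiction (ι zero) λ ()) ∷ (λ (ι , _) → contradiction (ι zero) λ ()) ∷ []))

-- Power series

scale : ℤ → Series → Series
scale c f n = c ℤ.* f n

-- The coefficient `(f * g) (suc n)` unfolds to `f 0 ℤ.* g (suc n) ℤ.+ (tail f * g) n`. The laws of
-- the product are therefore proved by induction on the index, passing to the tail of the first
-- factor.
*-cong : ∀ {f f′ g g′} → f ≈ f′ → g ≈ g′ → f * g ≈ f′ * g′
*-cong {f} {f′} {g} {g′} f≈f′ g≈g′ zero    = cong₂ (λ a b → a ℤ.* b ℤ.+ 0ℤ) (f≈f′ 0) (g≈g′ 0)
*-cong {f} {f′} {g} {g′} f≈f′ g≈g′ (suc n) = cong₂ ℤ._+_ (cong₂ ℤ._*_ (f≈f′ 0) (g≈g′ (suc n)))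
  (*-cong {tail f} {tail f′} {g} {g′} (λ n → f≈f′ (suc n)) g≈g′ n)

*-distribʳ : ∀ h f g → (f + g) * h ≈ f * h + g * h
*-distribʳ h f g zero    = lemma (f 0) (g 0) (h 0)
  where
  lemma : ∀ a b c → (a ℤ.+ b) ℤ.* c ℤ.+ 0ℤ ≡ (a ℤ.* c ℤ.+ 0ℤ) ℤ.+ (b ℤ.* c ℤ.+ 0ℤ)
  lemma = solve-∀
*-distribʳ h f g (suc n) = trans
  (cong (λ z → (f 0 ℤ.+ g 0) ℤ.* h (suc n) ℤ.+ z) (*-distribʳ h (tail f) (tail g) n))
  (lemma (f 0) (g 0) (h (suc n)) ((tail f * h) n) ((tail g * h) n))
  where
  lemma : ∀ a b c d e → (a ℤ.+ b) ℤ.* c ℤ.+ (d ℤ.+ e) ≡ (a ℤ.* c ℤ.+ d) ℤ.+ (b ℤ.* c ℤ.+ e)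
  lemma = solve-∀

scale-* : ∀ c f g → scale c f * g ≈ scale c (f * g)
scale-* c f g zero    = lemma c (f 0) (g 0)
  where
  lemma : ∀ c a b → c ℤ.* a ℤ.* b ℤ.+ 0ℤ ≡ c ℤ.* (a ℤ.* b ℤ.+ 0ℤ)
  lemma = solve-∀
scale-* c f g (suc n) = trans (cong (λ z → c ℤ.* f 0 ℤ.* g (suc n) ℤ.+ z) (scale-* c (tail f) g n))
  (lemma c (f 0) (g (suc n)) ((tail f * g) n))
  where
  lemma : ∀ c a b d → c ℤ.* a ℤ.* b ℤ.+ c ℤ.* d ≡ c ℤ.* (a ℤ.* b ℤ.+ d)
  lemma = solve-∀

-- The tail of `f * g` is `scale (f 0) (tail g) + tail f * g`, and the product with `h` distributes
-- over it.
*-assoc : ∀ f g h → (f * g) * h ≈ f * (g * h)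
*-assoc f g h zero    = lemma (f 0) (g 0) (h 0)
  where
  lemma : ∀ a b c → (a ℤ.* b ℤ.+ 0ℤ) ℤ.* c ℤ.+ 0ℤ ≡ a ℤ.* (b ℤ.* c ℤ.+ 0ℤ) ℤ.+ 0ℤ
  lemma = solve-∀
*-assoc f g h (suc n) = begin
  (f * g) 0 ℤ.* h (suc n) ℤ.+ ((scale (f 0) (tail g) + tail f * g) * h) n
    ≡⟨ cong (λ z → (f * g) 0 ℤ.* h (suc n) ℤ.+ z) (*-distribʳ h (scale (f 0) (tail g)) (tail f * g) n) ⟩
  (f * g) 0 ℤ.* h (suc n) ℤ.+ ((scale (f 0) (tail g) * h) n ℤ.+ (tail f * g * h) n)
    ≡⟨ cong₂ (λ y z → (f * g) 0 ℤ.* h (suc n) ℤ.+ (y ℤ.+ z))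
         (scale-* (f 0) (tail g) h n) (*-assoc (tail f) g h n) ⟩
  (f * g) 0 ℤ.* h (suc n) ℤ.+ (f 0 ℤ.* (tail g * h) n ℤ.+ (tail f * (g * h)) n)
    ≡⟨ lemma (f 0) (g 0) (h (suc n)) ((tail g * h) n) ((tail f * (g * h)) n) ⟩
  f 0 ℤ.* (g 0 ℤ.* h (suc n) ℤ.+ (tail g * h) n) ℤ.+ (tail f * (g * h)) n ∎
  where
  open ≡-Reasoning
  lemma : ∀ a b c d e → (a ℤ.* b ℤ.+ 0ℤ) ℤ.* c ℤ.+ (a ℤ.* d ℤ.+ e) ≡ a ℤ.* (b ℤ.* c ℤ.+ d) ℤ.+ e
  lemma = solve-∀

-- The mirror image of the defining recursion, splitting off the last term instead of the first, as
-- commutativity requires.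
*-sucʳ : ∀ f g n → (f * g) (suc n) ≡ f (suc n) ℤ.* g 0 ℤ.+ (f * tail g) n
*-sucʳ f g zero    = lemma (f 0 ℤ.* g 1) (f 1 ℤ.* g 0)
  where
  lemma : ∀ a b → a ℤ.+ (b ℤ.+ 0ℤ) ≡ b ℤ.+ (a ℤ.+ 0ℤ)
  lemma = solve-∀
*-sucʳ f g (suc n) = trans (cong (λ z → f 0 ℤ.* g (suc (suc n)) ℤ.+ z) (*-sucʳ (tail f) g n))
  (lemma (f 0 ℤ.* g (suc (suc n))) (f (suc (suc n)) ℤ.* g 0) ((tail f * tail g) n))
  where
  lemma : ∀ a b c → a ℤ.+ (b ℤ.+ c) ≡ b ℤ.+ (a ℤ.+ c)
  lemma = solve-∀

*-comm : ∀ f g → f * g ≈ g * f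
*-comm f g zero    = cong (ℤ._+ 0ℤ) (ℤ.*-comm (f 0) (g 0))
*-comm f g (suc n) = trans
  (cong₂ ℤ._+_ (ℤ.*-comm (f 0) (g (suc n))) (*-comm (tail f) g n)) (sym (*-sucʳ g f n))

0*-zero : ∀ f n → ((λ _ → 0ℤ) * f) n ≡ 0ℤ
0*-zero f zero    = refl
0*-zero f (suc n) = trans (ℤ.+-identityˡ _) (0*-zero f n)

const-* : ∀ c f → const c * f ≈ scale c f
const-* c f zero    = ℤ.+-identityʳ _
const-* c f (suc n) = trans (cong (λ z → c ℤ.* f (suc n) ℤ.+ z) (0*-zero f n)) (ℤ.+-identityʳ _)

1*-identity : ∀ f → 1# * f ≈ f
1*-identity f n = trans (const-* 1ℤ f n) (ℤ.*-identityˡ (f n))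

const-0 : const 0ℤ ≈ λ _ → 0ℤ
const-0 zero    = refl
const-0 (suc n) = refl

-- Additively this is the pointwise group, but its zero `const 0ℤ` is defined by cases on the index;
-- `const-0` adapts the identity and inverse laws.
series : CommutativeRing 0ℓ 0ℓ
series = record
  { Carrier = Series ; _≈_ = _≈_ ; _+_ = _+_ ; _*_ = _*_ ; -_ = -_ ; 0# = const 0ℤ ; 1# = 1#
  ; isCommutativeRing = record
    { isRing = record
      { +-isAbelianGroup = record
        { isGroup = record
          { isMonoid = record
            { isSemigroup = AbelianGroup.isSemigroup pointwise
            ; identity = (λ f n → trans (cong (ℤ._+ f n) (const-0 n)) (ℤ.+-identityˡ (f n))) ,
                         (λ f n → trans (cong (λ z → f n ℤ.+ z) (const-0 n)) (ℤ.+-identityʳ (f n)))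
            }
          ; inverse = (λ f n → trans (ℤ.+-inverseˡ (f n)) (sym (const-0 n))) ,
                      (λ f n → trans (ℤ.+-inverseʳ (f n)) (sym (const-0 n)))
          ; ⁻¹-cong = AbelianGroup.⁻¹-cong pointwise
          }
        ; comm = AbelianGroup.comm pointwise
        }
      ; *-cong = λ {f} {f′} {g} {g′} → *-cong {f} {f′} {g} {g′}
      ; *-assoc = *-assoc
      ; *-identity = 1*-identity , λ f n → trans (*-comm f 1# n) (1*-identity f n)
      ; distrib = (λ f g h n → trans (*-comm f (g + h) n) (trans (*-distribʳ f g h n)
                    (cong₂ ℤ._+_ (*-comm g f n) (*-comm h f n)))) , *-distribʳ
      }
    ; *-comm = *-comm
    }
  }
  where
  pointwise = Pointwise.abelianGroup ℕ ℤ.+-0-abelianGroup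

-- The constant coefficients agree because that of `g` is 1. Then `tail h` solves the same equation
-- for the remainder after one step of long division.
/-unique : ∀ {f g h} (g₀≡1 : g 0 ≡ 1ℤ) → h * g ≈ f → f / g ⟨ g₀≡1 ⟩ ≈ h
/-unique {f} {g} {h} g₀≡1 hg≈f zero    = begin
  f 0                   ≡⟨ hg≈f 0 ⟨
  h 0 ℤ.* g 0 ℤ.+ 0ℤ    ≡⟨ ℤ.+-identityʳ _ ⟩
  h 0 ℤ.* g 0           ≡⟨ cong (h 0 ℤ.*_) g₀≡1 ⟩
  h 0 ℤ.* 1ℤ            ≡⟨ ℤ.*-identityʳ _ ⟩
  h 0                   ∎
  where open ≡-Reasoning
/-unique {f} {g} {h} g₀≡1 hg≈f (suc n) = /-unique {h = tail h} g₀≡1 remainder n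
  where
  open ≡-Reasoning
  cancel : ∀ a b → b ≡ a ℤ.+ b ℤ.- a
  cancel = solve-∀
  remainder : tail h * g ≈ tail f - const (f 0) * tail g
  remainder m = begin
    (tail h * g) m                                                    ≡⟨ cancel (h 0 ℤ.* g (suc m)) _ ⟩
    (h * g) (suc m) ℤ.- h 0 ℤ.* g (suc m)
      ≡⟨ cong₂ (λ a b → a ℤ.- b ℤ.* g (suc m)) (hg≈f (suc m)) (sym (/-unique {g = g} {h} g₀≡1 hg≈f 0)) ⟩
    f (suc m) ℤ.- f 0 ℤ.* g (suc m)
      ≡⟨ cong (λ z → f (suc m) ℤ.- z) (const-* (f 0) (tail g) m) ⟨
    f (suc m) ℤ.- (const (f 0) * tail g) m                            ∎

x-*-suc : ∀ f n → (x * f) (suc n) ≡ f n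
x-*-suc f n = trans (ℤ.+-identityˡ _)
  (trans (*-cong {g = f} tail-x (λ _ → refl) n) (1*-identity f n))
  where
  tail-x : tail x ≈ 1#
  tail-x zero    = refl
  tail-x (suc n) = refl

-- The generating function without its constant term 1. The index is shifted because the binomial
-- coefficients are those of `n - 1`.
binomialSeries : ℕ → Series
binomialSeries l zero    = 0ℤ
binomialSeries l (suc m) = + binomialSum l m

-- Pascal's rule for series, with the terms in `G′` collected on the left. The summand `x` accounts
-- for the coefficient at index 1, where the binomial sum is 1.
binomialSeries-suc : ∀ l → (1# - x) * binomialSeries (suc l) ≈ x + x * binomialSeries l
binomialSeries-suc l n = trans (expand n)
  (trans (cong (ℤ._- (x * G′) n) (Pascal n)) (cancel (x n ℤ.+ (x * G) n) _))
  where
  open CommutativeRing series using (distribʳ; *-identityˡ; ring)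
  open RingProperties ring using (-‿distribˡ-*)
  G G′ : Series
  G  = binomialSeries l
  G′ = binomialSeries (suc l)
  cancel : ∀ a b → a ℤ.+ b ℤ.- b ≡ a
  cancel = solve-∀
  expand : (1# - x) * G′ ≈ G′ - x * G′
  expand n = trans (distribʳ G′ 1# (- x) n) (cong₂ ℤ._+_ (*-identityˡ G′ n) (sym (-‿distribˡ-* x G′ n)))
  Pascal : G′ ≈ x + x * G + x * G′
  Pascal zero          = refl
  Pascal (suc zero)    = begin
    + binomialSum (suc l) 0                         ≡⟨ cong +_ (binomialSum-zero l) ⟩
    1ℤ
      ≡⟨ cong₂ (λ a b → 1ℤ ℤ.+ a ℤ.+ b) (x-*-suc G 0) (x-*-suc G′ 0) ⟨
    1ℤ ℤ.+ (x * G) 1 ℤ.+ (x * G′) 1                 ∎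
    where open ≡-Reasoning
  Pascal (suc (suc m)) = begin
    + binomialSum (suc l) (suc m)                   ≡⟨ cong +_ (binomialSum-suc l m) ⟩
    + (binomialSum l m ℕ.+ binomialSum (suc l) m)   ≡⟨ ℤ.pos-+ (binomialSum l m) _ ⟩
    G (suc m) ℤ.+ G′ (suc m)
      ≡⟨ cong₂ ℤ._+_ (trans (ℤ.+-identityˡ _) (x-*-suc G (suc m))) (x-*-suc G′ (suc m)) ⟨
    0ℤ ℤ.+ (x * G) (suc (suc m)) ℤ.+ (x * G′) (suc (suc m)) ∎
    where open ≡-Reasoning

-- The closed form with the denominator cleared, by induction on `l`. The recurrence supplies one
-- factor `1# - x`, and `(1 - 2x) + x = 1 - x` recombines the two resulting terms.
binomialSeries-* : ∀ l → binomialSeries l * ((1# - const (+ 2) * x) * (1# - x) ^ l)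
                         ≈ x * (1# - x) ^ l - x ^ suc l
binomialSeries-* zero = begin
  binomialSeries 0 * (T * 1#)  ≈⟨ R.*-congʳ {x = T * 1#} {binomialSeries 0} {const 0ℤ} empty ⟩
  const 0ℤ * (T * 1#)          ≈⟨ R.zeroˡ (T * 1#) ⟩
  const 0ℤ                     ≈⟨ R.-‿inverseʳ (x * 1#) ⟨
  x * 1# - x * 1#              ∎
  where
  module R = CommutativeRing series
  open SetoidReasoning R.setoid
  T = 1# - const (+ 2) * x
  empty : binomialSeries 0 ≈ const 0ℤ
  empty zero    = refl
  empty (suc n) = refl
binomialSeries-* (suc l) = begin
  G′ * (T * (Y * P))
    ≈⟨ solve 4 (λ g t y p → g :* (t :* (y :* p)) := (y :* g) :* (t :* p)) (λ _ → refl) G′ T Y P ⟩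
  (Y * G′) * (T * P)
    ≈⟨ *-cong {g = T * P} (binomialSeries-suc l) (λ _ → refl) ⟩
  (x + x * G) * (T * P)
    ≈⟨ solve 4 (λ x g t p → (x :+ x :* g) :* (t :* p) := x :* (t :* p) :+ x :* (g :* (t :* p)))
         (λ _ → refl) x G T P ⟩
  x * (T * P) + x * (G * (T * P))
    ≈⟨ R.+-congˡ {x = x * (T * P)} (*-cong {x} (λ _ → refl) (binomialSeries-* l)) ⟩
  x * (T * P) + x * (x * P - Q)
    -- The solver works over semirings, so `- Q` enters as a variable of its own.
    ≈⟨ solve 4 (λ x t p q → x :* (t :* p) :+ x :* (x :* p :+ q) := x :* ((t :+ x) :* p) :+ x :* q)
         (λ _ → refl) x T P (- Q) ⟩
  x * ((T + x) * P) + x * - Q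
    ≈⟨ R.+-cong {x = x * ((T + x) * P)} (*-cong {x} (λ _ → refl) (*-cong {g = P} T+x≈Y (λ _ → refl)))
         (λ n → sym (-‿distribʳ-* x Q n)) ⟩
  x * (Y * P) - x * Q ∎
  where
  module R = CommutativeRing series
  open RingProperties R.ring using (-‿distribʳ-*)
  open RingSolver R.commutativeSemiring
  open SetoidReasoning R.setoid
  G = binomialSeries l
  G′ = binomialSeries (suc l)
  T = 1# - const (+ 2) * x
  Y = 1# - x
  P = Y ^ l
  Q = x ^ suc l
  lemma : ∀ a b → a ℤ.- (+ 2) ℤ.* b ℤ.+ b ≡ a ℤ.- b
  lemma = solve-∀
  T+x≈Y : T + x ≈ Y
  T+x≈Y n = trans (cong (λ z → 1# n ℤ.- z ℤ.+ x n) (const-* (+ 2) x n)) (lemma (1# n) (x n))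

-- The counting formula and its generating function

proposition6p2 :
    (k : ℕ) → 1 ℕ.≤ k →
    (σ : Permutation′ k) → F k (p123 ∷ []) σ → ¬ (σ Perm.≈ Perm.reverse) →
    (∀ n → ∣F∣ n (p123 ∷ (k , σ) ∷ []) ≡ Σℕ {k ∸ 1} (λ j → binomial[ n -1] (toℕ j))) ×
    (generatingFunction (λ n → ∣F∣ n (p123 ∷ (k , σ) ∷ [])) ≈
      1# + (x * (1# - x) ^ (k ∸ 1) - x ^ k)
           / ((1# - const (+ 2) * x) * (1# - x) ^ (k ∸ 1)) ⟨ denominator-constant (k ∸ 1) ⟩)
proposition6p2 (suc l) _ σ σ∈F σ≉rev with F-123⇒encodes σ σ∈F
... | u , eσ = count , series-identity
  where
  -- For `n = 0` the sum is 1 only if it has a term at all. A bottom before the last position of `σ`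
  -- forces `l` to be positive.
  positive : ∀ {l} {i : Fin (suc l)} → i < fromℕ l → Σℕ {l} (λ j → binomial[ 0 -1] (toℕ j)) ≡ 1
  positive {suc l} _ = cong suc (∑.sum-replicate-zero l)

  -- The word of `σ` has length `l = k - 1`, so the indices below `l` are those up to `k - 2`.
  count : ∀ n → ∣F∣ n (p123 ∷ (suc l , σ) ∷ []) ≡ Σℕ {l} (λ j → binomial[ n -1] (toℕ j))
  count zero    = trans (∣F∣-zero eσ σ≉rev) (sym (positive (not-reverse⇒ascent eσ σ≉rev)))
  count (suc m) = ∣F∣-suc eσ σ≉rev m

  quotient : Series
  quotient = (x * (1# - x) ^ l - x ^ suc l)
    / ((1# - const (+ 2) * x) * (1# - x) ^ l) ⟨ denominator-constant l ⟩

  quotient≈ : quotient ≈ binomialSeries l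
  quotient≈ = /-unique {h = binomialSeries l} (denominator-constant l) (binomialSeries-* l)

  series-identity : generatingFunction (λ n → ∣F∣ n (p123 ∷ (suc l , σ) ∷ [])) ≈ 1# + quotient
  series-identity zero    = trans (cong +_ (∣F∣-zero eσ σ≉rev)) (cong (λ z → 1ℤ ℤ.+ z) (sym (quotient≈ 0)))
  series-identity (suc m) = trans (cong +_ (∣F∣-suc eσ σ≉rev m))
    (trans (sym (quotient≈ (suc m))) (sym (ℤ.+-identityˡ (quotient (suc m)))))
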